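{- Let $s\geq 1$, $d\geq 1$ and $m\geq 2$ be integers, and let $n=m-1$. For every admissible increment matrix $\kappa=(\kappa_1,\dots,\kappa_n)$ and every spot $j\in\mathbb{Z}_m$, $$\bigl|\{A\in\mathcal{C}_\kappa:\ E(A)=j\}\bigr|=m^{\,n-1},$$ where $\mathcal{C}_\kappa$ is the set of circular preferences with increment matrix $\kappa$ and $E(A)\in\mathbb{Z}_m$ is the unique spot left empty after circular parking with preference $A$.
   Context: Let $m\geq 2$. The spots are the elements of $\mathbb{Z}_m=\{1,\dots,m\}$, arranged clockwise on a circle. For $x\in\mathbb{Z}_m$ and an integer $k\geq 0$, $x\oplus k$ denotes clockwise displacement of $x$ by $k$, i.e. addition modulo $m$. Admissible tuples: fix integers $s\geq 1$ and $d\geq 1$. An admissible $s$-tuple is a tuple $(a_1,\dots,a_s)=\bigl(a,\ a\oplus k_1,\ a\oplus(k_1+k_2),\ \dots,\ a\oplus(k_1+\cdots+k_{s-1})\bigr)$ with $a\in\mathbb{Z}_m$ (the anchor) and integers $k_i\geq d$ for $1\le i\le s-1$ (the increments) such that $k_1+\cdots+k_{s-1}\leq m-d$ (for $s=1$ the sum is empty and equals $0$). Circular parking: let $n=m-1$. Cars $c_1,\dots,c_n$ enter in this order, each carrying an admissible $s$-tuple; all spots are initially free. Each car tries the spots of its tuple in the order $a_1,a_2,\dots,a_s$ and parks in the first one that is free; if all of them are occupied, it sweeps clockwise starting from its last choice $a_s$ (visiting $a_s\oplus 1, a_s\oplus 2,\dots$) and parks in the first free spot. A circular preference $A$ is a choice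 of an admissible $s$-tuple for each of the $n$ cars; the set of circular preferences is $\mathcal{C}_m^{s,d}$. Since $n<m$, every car parks and exactly one spot, denoted $E(A)$, remains empty. Increment classes: for a circular preference $A$, let $\kappa_i=(k_{1,i},\dots,k_{s-1,i})$ be the increment vector of the tuple of car $c_i$ ($1\le i\le n$); the increment matrix of $A$ is $\kappa=(\kappa_1,\dots,\kappa_n)$. An increment matrix $\kappa$ is admissible if for each $i$ the entries of $\kappa_i$ are integers $\geq d$ with $k_{1,i}+\cdots+k_{s-1,i}\leq m-d$. For such $\kappa$, $\mathcal{C}_\kappa=\{A\in\mathcal{C}_m^{s,d}: A\text{ has increment matrix }\kappa\}$. -}

module Defs where

open import Data.Nat using (ℕ; zero; suc; _+_; _∸_; _≤_)
open import Data.Nat.DivMod using (_mod_)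
open import Data.Nat.ListAction using (sum)
open import Data.Fin using (Fin; toℕ; _≟_)
open import Data.List as List using (List; []; _∷_; length)
open import Data.List.Membership.Propositional using (_∈_; _∉_)
open import Data.List.Membership.DecPropositional using (_∉?_)
open import Data.List.Relation.Unary.Unique.Propositional using (Unique)
open import Data.Maybe using (maybe)
open import Data.Product using (_×_; ∃-syntax)
open import Data.Vec as Vec using (Vec; []; _∷_; toList; tabulate; last)
open import Data.Vec.Relation.Unary.All using (All)
open import Data.Vec.Relation.Binary.Pointwise.Inductive using (Pointwise)
open import Function using (_⇔_)
open import Relation.Binary.PropositionalEquality using (_≡_)

HasCardinality : {A : Set} → (A → Set) → ℕ → Set
HasCardinality {A} P k =
  ∃[ xs ] Unique xs × (∀ (x : A) → x ∈ xs ⇔ P x) × length xs ≡ k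

-- The spot called m on a circle of m spots is here zero : Fin m.

infixl 6 _⊕_

_⊕_ : ∀ {m} → Fin m → ℕ → Fin m
_⊕_ {suc m} x k = (toℕ x + k) mod suc m

Increments : ℕ → Set
Increments s = Vec ℕ (s ∸ 1)

-- The bound k₁ + ⋯ + k₍ₛ₋₁₎ ≤ m − d is an inequality of integers (d may exceed
-- m), hence the form without truncated subtraction.

AdmissibleIncrements : (m d : ℕ) {s : ℕ} → Increments s → Set
AdmissibleIncrements m d k = All (d ≤_) k × Vec.sum k + d ≤ m

Tuple : (m s : ℕ) → Set
Tuple m s = Vec (Fin m) s

-- At the 0-based index i the sum has the i summands k₁, …, kᵢ.

tuple : ∀ {m s} → Fin m → Increments s → Tuple m s
tuple a k = tabulate λ i → a ⊕ sum (List.take (toℕ i) (toList k))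

HasIncrements : (d : ℕ) {m s : ℕ} → Tuple m s → Increments s → Set
HasIncrements d {m} {s} t k =
  AdmissibleIncrements m d {s} k × ∃[ a ] t ≡ tuple a k

AdmissibleTuple : (d : ℕ) {m s : ℕ} → Tuple m s → Set
AdmissibleTuple d t = ∃[ k ] HasIncrements d t k

-- One tuple for each of the n = m − 1 cars, in order of arrival.

Preferences : (m s : ℕ) → Set
Preferences m s = Vec (Tuple m s) (m ∸ 1)

IncrementMatrix : (m s : ℕ) → Set
IncrementMatrix m s = Vec (Increments s) (m ∸ 1)

AdmissibleMatrix : (m s d : ℕ) → IncrementMatrix m s → Set
AdmissibleMatrix m s d κ = All (AdmissibleIncrements m d {s}) κ

CircularPreference : (m s d : ℕ) → Preferences m s → Set
CircularPreference m s d A = All (AdmissibleTuple d) A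

IncrementClass : (m s d : ℕ) → IncrementMatrix m s → Preferences m s → Set
IncrementClass m s d κ A =
  CircularPreference m s d A × Pointwise (HasIncrements d) A κ

-- After m − 1 steps clockwise from its last choice a car has seen every spot.

sweep : ∀ {m s} → Tuple m s → List (Fin m)
sweep {m} []        = []
sweep {m} t@(_ ∷ _) = List.applyUpTo (λ i → last t ⊕ suc i) (m ∸ 1)

visited : ∀ {m s} → Tuple m s → List (Fin m)
visited t = toList t List.++ sweep t

-- With fewer than m spots occupied, find never returns nothing.

parkCar : ∀ {m s} → List (Fin m) → Tuple m s → List (Fin m)
parkCar occ t =
  maybe (_∷ occ) occ (List.find (λ x → _∉?_ _≟_ x occ) (visited t))

occupied : ∀ {m s} → Preferences m s → List (Fin m)
occupied A = List.foldl parkCar [] (toList A)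

-- E(A) = j, as a relation: j is the one and only spot left empty.

EmptySpot : ∀ {m s} → Preferences m s → Fin m → Set
EmptySpot A j = j ∉ occupied A × (∀ i → i ∉ occupied A → i ≡ j)

{-# OPTIONS --safe #-}

-- Rotating all anchors by r rotates every tuple, hence the whole parking
-- process and the empty spot, by r.  So in each rotation orbit of circular
-- preferences the empty spot takes every value exactly once.  The orbits are
-- represented by the preferences whose first anchor is zero, and these are
-- given freely by the other n − 1 anchors.

module Submission where

open import Defs
open import Data.Bool using (true; false)
open import Data.Fin using (Fin; zero; suc; toℕ; _≟_)
open import Data.Fin.Properties
  using (toℕ-fromℕ<; toℕ-injective; toℕ<n; toℕ≤n; ¬∀⟶∃¬; injective⇒≤)
open import Data.List as List
  using (List; []; _∷_; length; allFin; cartesianProductWith)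
open import Data.List.Membership.DecPropositional using (_∉?_; _∈?_)
open import Data.List.Membership.Propositional using (_∈_; _∉_; lose)
open import Data.List.Membership.Propositional.Properties
  using (∈-map⁺; ∈-map⁻; ∈-lookup; ∈-allFin; ∈-cartesianProductWith⁺;
         ∈-applyUpTo⁺; ∈-++⁺ˡ; ∈-++⁺ʳ)
open import Data.List.Membership.Setoid.Properties using (index-injective)
open import Data.List.Properties
  using (length-map; length-++; length-tabulate; map-++; map-applyUpTo)
open import Data.List.Relation.Unary.All as All using ()
open import Data.List.Relation.Unary.All.Properties using (¬Any⇒All¬)
open import Data.List.Relation.Unary.AllPairs using ([]; _∷_)
open import Data.List.Relation.Unary.Any as Any using (Any; here; there)
open import Data.List.Relation.Unary.Unique.Propositional using (Unique)
open import Data.List.Relation.Unary.Unique.Propositional.Properties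
  using (allFin⁺; cartesianProductWith⁺; map⁺)
open import Data.Maybe as Maybe using (Maybe; just; nothing; maybe)
open import Data.Nat
  using (ℕ; zero; suc; _+_; _*_; _∸_; _^_; _≤_; _<_; s≤s; s≤s⁻¹; NonZero)
open import Data.Nat.DivMod
  using (_%_; m%n<n; m<n⇒m%n≡m; %-distribˡ-+; m%n%n≡m%n; [m+n]%n≡m%n; [m+kn]%n≡m%n)
open import Data.Nat.Properties
  using (+-assoc; +-comm; +-identityʳ; +-suc; *-suc; m+[n∸m]≡n; ≤-reflexive;
         m+n≤o⇒m≤o; m<n⇒m<1+n; <⇒≱; n≮n)
open import Data.Product using (_×_; _,_; proj₁; proj₂; ∃-syntax)
open import Data.Unit using (⊤; tt)
open import Data.Vec as Vec using (Vec; []; _∷_; last; toList)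
open import Data.Vec.Properties
  using (∷-injective; map-∘; map-cong; map-id; tabulate-∘; tabulate-cong; toList-map)
open import Data.Vec.Relation.Unary.All as VecAll using ([]; _∷_)
open import Data.Vec.Relation.Binary.Pointwise.Inductive using (Pointwise; []; _∷_)
open import Function using (_∘_; mk⇔; Injective)
open import Function.Bundles using (module Equivalence)
open import Relation.Binary.PropositionalEquality
  using (_≡_; refl; sym; trans; cong; cong₂; subst; setoid; module ≡-Reasoning)
open import Relation.Nullary using (yes; no; does; contradiction)
open import Relation.Nullary.Decidable using (does-⇔)
open import Relation.Unary using (Decidable)

open ≡-Reasoning

private variable
  A B C : Set
  k l m n s : ℕ

-- Counting by lists.

length-cartesianProductWith : (f : A → B → C) (xs : List A) (ys : List B) →
  length (cartesianProductWith f xs ys) ≡ length xs * length ys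
length-cartesianProductWith f []       ys = refl
length-cartesianProductWith f (x ∷ xs) ys = trans
  (length-++ (List.map (f x) ys))
  (cong₂ _+_ (length-map (f x) ys) (length-cartesianProductWith f xs ys))

hasCardinality-Vec : ∀ m n → HasCardinality {Vec (Fin m) n} (λ _ → ⊤) (m ^ n)
hasCardinality-Vec m zero =
  ([] ∷ []) , All.[] ∷ [] , (λ { [] → mk⇔ (λ _ → tt) (λ _ → here refl) }) , refl
hasCardinality-Vec m (suc n) with hasCardinality-Vec m n
... | vs , vs! , vs-full , |vs| =
  cartesianProductWith _∷_ (allFin m) vs ,
  cartesianProductWith⁺ _∷_ ∷-injective (allFin⁺ m) vs! ,
  (λ { (x ∷ v) → mk⇔ (λ _ → tt) λ _ →
    ∈-cartesianProductWith⁺ _∷_ (∈-allFin x) (Equivalence.from (vs-full v) tt) }) ,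
  trans (length-cartesianProductWith _∷_ (allFin m) vs)
        (cong₂ _*_ (length-tabulate {n = m} (λ i → i)) |vs|)

-- Counting through a parametrisation: the theorem uses it with `fibre`, which maps vectors of free
-- anchors onto the preferences to be counted.
hasCardinality-image : {P : B → Set} (f : A → B) → Injective _≡_ _≡_ f →
  (∀ x → P (f x)) → (∀ {y} → P y → ∃[ x ] y ≡ f x) →
  HasCardinality {A} (λ _ → ⊤) k → HasCardinality P k
hasCardinality-image {P = P} f f-inj Pf P⇒image (xs , xs! , xs-full , |xs|) =
  List.map f xs , map⁺ f-inj xs! , (λ y → mk⇔ to from) , trans (length-map f xs) |xs|
  where
  to : ∀ {y} → y ∈ List.map f xs → P y
  to y∈ with x , _ , refl ← ∈-map⁻ f y∈ = Pf x

  from : ∀ {y} → P y → y ∈ List.map f xs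
  from Py with x , refl ← P⇒image Py = ∈-map⁺ f (Equivalence.from (xs-full x) tt)

-- Pigeonhole, searching in lists, last entries of vectors.

lookup-injective : {xs : List A} → Unique xs → ∀ i j →
  List.lookup xs i ≡ List.lookup xs j → i ≡ j
lookup-injective (_  ∷ _) zero    zero    _  = refl
lookup-injective (x∉ ∷ _) zero    (suc j) eq = contradiction eq (All.lookup x∉ (∈-lookup j))
lookup-injective (x∉ ∷ _) (suc i) zero    eq = contradiction (sym eq) (All.lookup x∉ (∈-lookup i))
lookup-injective (_  ∷ u) (suc i) (suc j) eq = cong suc (lookup-injective u i j eq)

unique⇒length≤ : {xs : List (Fin m)} → Unique xs → length xs ≤ m
unique⇒length≤ {xs = xs} u = injective⇒≤ {f = List.lookup xs} (lookup-injective u _ _)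

-- Pigeonhole: if every spot were in `xs`, sending a spot to its position would inject `Fin m` into
-- the positions of `xs`.
∃∉ : (xs : List (Fin m)) → length xs < m → ∃[ x ] x ∉ xs
∃∉ {m} xs |xs|<m = ¬∀⟶∃¬ m (_∈ xs) (λ x → _∈?_ _≟_ x xs) λ all∈ →
  <⇒≱ |xs|<m (injective⇒≤ {f = λ x → Any.index (all∈ x)}
    (index-injective (setoid _) (all∈ _) (all∈ _)))

∉⇒Unique-∷ : {x : A} {xs : List A} → x ∉ xs → Unique xs → Unique (x ∷ xs)
∉⇒Unique-∷ x∉ u = ¬Any⇒All¬ _ x∉ ∷ u

-- The search inspects only the booleans `does`, so agreement of these makes it commute with `f`;
-- later `f` is a rotation.
find-map : {P : A → Set} {Q : B → Set} (P? : Decidable P) (Q? : Decidable Q) (f : A → B) →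
  (∀ x → does (Q? (f x)) ≡ does (P? x)) →
  ∀ xs → List.find Q? (List.map f xs) ≡ Maybe.map f (List.find P? xs)
find-map P? Q? f eq []       = refl
find-map P? Q? f eq (x ∷ xs) with does (Q? (f x)) | does (P? x) | eq x
... | true  | _ | refl = refl
... | false | _ | refl = find-map P? Q? f eq xs

find⁺ : {P : A → Set} (P? : Decidable P) {xs : List A} → Any P xs →
  ∃[ x ] P x × List.find P? xs ≡ just x
find⁺ P? {x ∷ xs} p∈ with P? x
... | yes px = x , px , refl
find⁺ P? {x ∷ xs} (here px)  | no ¬px = contradiction px ¬px
find⁺ P? {x ∷ xs} (there p∈) | no _   = find⁺ P? p∈

-- `last` is computed through `Vec.initLast`, so the two sides agree by `refl` only once the split
-- of the tail is in view.
last-∷∷ : ∀ x y (xs : Vec A n) → last (x ∷ y ∷ xs) ≡ last (y ∷ xs)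
last-∷∷ x y xs with Vec.initLast (y ∷ xs)
... | _ , _ , _ = refl

last-map : (f : A → B) (xs : Vec A (suc n)) → last (Vec.map f xs) ≡ f (last xs)
last-map f (x ∷ [])     = refl
last-map f (x ∷ y ∷ xs) = begin
  last (f x ∷ f y ∷ Vec.map f xs) ≡⟨ last-∷∷ (f x) (f y) (Vec.map f xs) ⟩
  last (Vec.map f (y ∷ xs))       ≡⟨ last-map f (y ∷ xs) ⟩
  f (last (y ∷ xs))               ≡⟨ cong f (last-∷∷ x y xs) ⟨
  f (last (x ∷ y ∷ xs))           ∎

last∈toList : (xs : Vec A (suc n)) → last xs ∈ toList xs
last∈toList (x ∷ [])     = here refl
last∈toList (x ∷ y ∷ xs) =
  there (subst (_∈ toList (y ∷ xs)) (sym (last-∷∷ x y xs)) (last∈toList (y ∷ xs)))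

map-injective : {f : A → B} → Injective _≡_ _≡_ f → Injective _≡_ _≡_ (Vec.map {n = n} f)
map-injective f-inj {[]}     {[]}     _  = refl
map-injective f-inj {x ∷ xs} {y ∷ ys} eq =
  cong₂ _∷_ (f-inj (proj₁ (∷-injective eq))) (map-injective f-inj (proj₂ (∷-injective eq)))

-- Arithmetic of displacements on the circle.

toℕ-⊕ : (x : Fin (suc n)) (k : ℕ) → toℕ (x ⊕ k) ≡ (toℕ x + k) % suc n
toℕ-⊕ {n} x k = toℕ-fromℕ< (m%n<n (toℕ x + k) (suc n))

[m%d+n]%d≡[m+n]%d : ∀ m n d .{{_ : NonZero d}} → (m % d + n) % d ≡ (m + n) % d
[m%d+n]%d≡[m+n]%d m n d = begin
  (m % d + n) % d           ≡⟨ %-distribˡ-+ (m % d) n d ⟩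
  (m % d % d + n % d) % d   ≡⟨ cong (λ z → (z + n % d) % d) (m%n%n≡m%n m d) ⟩
  (m % d + n % d) % d       ≡⟨ %-distribˡ-+ m n d ⟨
  (m + n) % d               ∎

⊕-⊕ : (x : Fin (suc n)) (k l : ℕ) → x ⊕ k ⊕ l ≡ x ⊕ (k + l)
⊕-⊕ {n} x k l = toℕ-injective (begin
  toℕ (x ⊕ k ⊕ l)                     ≡⟨ toℕ-⊕ (x ⊕ k) l ⟩
  (toℕ (x ⊕ k) + l) % suc n           ≡⟨ cong (λ z → (z + l) % suc n) (toℕ-⊕ x k) ⟩
  ((toℕ x + k) % suc n + l) % suc n   ≡⟨ [m%d+n]%d≡[m+n]%d (toℕ x + k) l (suc n) ⟩
  (toℕ x + k + l) % suc n             ≡⟨ cong (_% suc n) (+-assoc (toℕ x) k l) ⟩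
  (toℕ x + (k + l)) % suc n           ≡⟨ toℕ-⊕ x (k + l) ⟨
  toℕ (x ⊕ (k + l))                   ∎)

⊕-comm : (x : Fin (suc n)) (k l : ℕ) → x ⊕ k ⊕ l ≡ x ⊕ l ⊕ k
⊕-comm x k l = begin
  x ⊕ k ⊕ l   ≡⟨ ⊕-⊕ x k l ⟩
  x ⊕ (k + l) ≡⟨ cong (x ⊕_) (+-comm k l) ⟩
  x ⊕ (l + k) ≡⟨ ⊕-⊕ x l k ⟨
  x ⊕ l ⊕ k   ∎

⊕-multiple : (x : Fin (suc n)) (k : ℕ) → x ⊕ k * suc n ≡ x
⊕-multiple {n} x k = toℕ-injective (begin
  toℕ (x ⊕ k * suc n)           ≡⟨ toℕ-⊕ x (k * suc n) ⟩
  (toℕ x + k * suc n) % suc n   ≡⟨ [m+kn]%n≡m%n (toℕ x) k (suc n) ⟩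
  toℕ x % suc n                 ≡⟨ m<n⇒m%n≡m (toℕ<n x) ⟩
  toℕ x                         ∎)

-- Modulo `suc n` the number `n` is -1, so the natural number `k * n` serves as -k.
⊕-inverse : (x : Fin (suc n)) (k : ℕ) → x ⊕ k ⊕ k * n ≡ x
⊕-inverse {n} x k = begin
  x ⊕ k ⊕ k * n    ≡⟨ ⊕-⊕ x k (k * n) ⟩
  x ⊕ (k + k * n)  ≡⟨ cong (x ⊕_) (*-suc k n) ⟨
  x ⊕ k * suc n    ≡⟨ ⊕-multiple x k ⟩
  x                ∎

⊕-inverse′ : (x : Fin (suc n)) (k : ℕ) → x ⊕ k * n ⊕ k ≡ x
⊕-inverse′ {n} x k = trans (⊕-comm x (k * n) k) (⊕-inverse x k)

⊕-injective : (k : ℕ) → Injective _≡_ _≡_ (λ (x : Fin (suc n)) → x ⊕ k)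
⊕-injective {n} k {x} {y} eq = begin
  x             ≡⟨ ⊕-inverse x k ⟨
  x ⊕ k ⊕ k * n ≡⟨ cong (_⊕ k * n) eq ⟩
  y ⊕ k ⊕ k * n ≡⟨ ⊕-inverse y k ⟩
  y             ∎

-- Congruent to y - x modulo m, but not reduced: the value lies between 1 and 2m - 1, and the
-- distance from a spot to itself is m.
distance : Fin m → Fin m → ℕ
distance {m} x y = (m ∸ toℕ x) + toℕ y

⊕-distance : (x y : Fin (suc n)) → x ⊕ distance x y ≡ y
⊕-distance {n} x y = toℕ-injective (begin
  toℕ (x ⊕ distance x y)
    ≡⟨ toℕ-⊕ x (distance x y) ⟩
  (toℕ x + ((suc n ∸ toℕ x) + toℕ y)) % suc n
    ≡⟨ cong (_% suc n) (+-assoc (toℕ x) (suc n ∸ toℕ x) (toℕ y)) ⟨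
  (toℕ x + (suc n ∸ toℕ x) + toℕ y) % suc n
    ≡⟨ cong (λ z → (z + toℕ y) % suc n) (m+[n∸m]≡n (toℕ≤n x)) ⟩
  (suc n + toℕ y) % suc n
    ≡⟨ cong (_% suc n) (+-comm (suc n) (toℕ y)) ⟩
  (toℕ y + suc n) % suc n
    ≡⟨ [m+n]%n≡m%n (toℕ y) (suc n) ⟩
  toℕ y % suc n
    ≡⟨ m<n⇒m%n≡m (toℕ<n y) ⟩
  toℕ y ∎)

-- Every `y` is a displacement of `x`, and displacements commute, so a rotation is determined by its
-- effect on one spot. This replaces equality of `k` and `l`, which in general holds only modulo
-- `suc n`.
⊕-free : (x : Fin (suc n)) → x ⊕ k ≡ x ⊕ l → ∀ y → y ⊕ k ≡ y ⊕ l
⊕-free {k = k} {l = l} x eq y = begin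
  y ⊕ k                  ≡⟨ cong (_⊕ k) (⊕-distance x y) ⟨
  x ⊕ distance x y ⊕ k   ≡⟨ ⊕-comm x _ k ⟩
  x ⊕ k ⊕ distance x y   ≡⟨ cong (_⊕ distance x y) eq ⟩
  x ⊕ l ⊕ distance x y   ≡⟨ ⊕-comm x l _ ⟩
  x ⊕ distance x y ⊕ l   ≡⟨ cong (_⊕ l) (⊕-distance x y) ⟩
  y ⊕ l                  ∎

⊕-% : (x : Fin (suc n)) (k : ℕ) → x ⊕ k % suc n ≡ x ⊕ k
⊕-% {n} x k = toℕ-injective (begin
  toℕ (x ⊕ k % suc n)           ≡⟨ toℕ-⊕ x (k % suc n) ⟩
  (toℕ x + k % suc n) % suc n   ≡⟨ cong (_% suc n) (+-comm (toℕ x) (k % suc n)) ⟩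
  (k % suc n + toℕ x) % suc n   ≡⟨ [m%d+n]%d≡[m+n]%d k (toℕ x) (suc n) ⟩
  (k + toℕ x) % suc n           ≡⟨ cong (_% suc n) (+-comm k (toℕ x)) ⟩
  (toℕ x + k) % suc n           ≡⟨ toℕ-⊕ x k ⟨
  toℕ (x ⊕ k)                   ∎)

-- Rotation equivariance of parking.

rotate : ℕ → Vec (Fin m) k → Vec (Fin m) k
rotate r = Vec.map (_⊕ r)

-- Each entry is the anchor displaced by an amount that depends on the increments alone, and
-- displacements commute.
tuple-⊕ : (r : ℕ) (a : Fin (suc n)) (k : Increments s) →
  tuple {s = s} (a ⊕ r) k ≡ rotate r (tuple a k)
tuple-⊕ r a k = trans (tabulate-cong λ _ → ⊕-comm a r _) (tabulate-∘ (_⊕ r) _)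

sweep-rotate : (r : ℕ) (t : Tuple (suc n) s) → sweep (rotate r t) ≡ List.map (_⊕ r) (sweep t)
sweep-rotate r []         = refl
sweep-rotate {n} r t@(_ ∷ _) = trans
  (applyUpTo-cong n λ i → trans (cong (_⊕ suc i) (last-map (_⊕ r) t)) (⊕-comm (last t) r (suc i)))
  (sym (map-applyUpTo (λ i → last t ⊕ suc i) (_⊕ r) n))
  where
  applyUpTo-cong : {f g : ℕ → A} → ∀ n → (∀ i → f i ≡ g i) →
    List.applyUpTo f n ≡ List.applyUpTo g n
  applyUpTo-cong zero    eq = refl
  applyUpTo-cong (suc n) eq = cong₂ _∷_ (eq 0) (applyUpTo-cong n (eq ∘ suc))

visited-rotate : (r : ℕ) (t : Tuple (suc n) s) → visited (rotate r t) ≡ List.map (_⊕ r) (visited t)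
visited-rotate r t = trans
  (cong₂ List._++_ (toList-map (_⊕ r) t) (sweep-rotate r t))
  (sym (map-++ (_⊕ r) (toList t) (sweep t)))

∈-map-injective : {f : A → B} → Injective _≡_ _≡_ f → ∀ {x xs} → f x ∈ List.map f xs → x ∈ xs
∈-map-injective f-inj fx∈ with y , y∈ , eq ← ∈-map⁻ _ fx∈ =
  subst (_∈ _) (sym (f-inj eq)) y∈

-- A rotation is injective, so a spot is free exactly when its image is free after rotating the
-- occupied spots; the two searches therefore stop at corresponding spots.
parkCar-rotate : (r : ℕ) (occ : List (Fin (suc n))) (t : Tuple (suc n) s) →
  parkCar (List.map (_⊕ r) occ) (rotate r t) ≡ List.map (_⊕ r) (parkCar occ t)
parkCar-rotate r occ t = begin
  park (List.find free′? (visited (rotate r t)))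
    ≡⟨ cong (park ∘ List.find free′?) (visited-rotate r t) ⟩
  park (List.find free′? (List.map (_⊕ r) (visited t)))
    ≡⟨ cong park (find-map free? free′? (_⊕ r) same (visited t)) ⟩
  park (Maybe.map (_⊕ r) (List.find free? (visited t)))
    ≡⟨ park-map (List.find free? (visited t)) ⟩
  List.map (_⊕ r) (parkCar occ t) ∎
  where
  occ′ = List.map (_⊕ r) occ
  free? = λ x → _∉?_ _≟_ x occ
  free′? = λ x → _∉?_ _≟_ x occ′

  park : Maybe (Fin _) → List (Fin _)
  park = maybe (_∷ occ′) occ′

  same : ∀ x → does (free′? (x ⊕ r)) ≡ does (free? x)
  same x = does-⇔
    (mk⇔ (λ x∉ → x∉ ∘ ∈-map⁺ (_⊕ r)) (λ x∉ → x∉ ∘ ∈-map-injective (⊕-injective r)))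
    (free′? (x ⊕ r)) (free? x)

  park-map : ∀ x → park (Maybe.map (_⊕ r) x) ≡ List.map (_⊕ r) (maybe (_∷ occ) occ x)
  park-map (just x) = refl
  park-map nothing  = refl

-- The initial list `occ` is arbitrary for the sake of the induction over the cars. The whole
-- process is the case `[]`, which rotation fixes.
foldl-parkCar-rotate : (r : ℕ) (occ : List (Fin (suc n))) (ts : Vec (Tuple (suc n) s) k) →
  List.foldl parkCar (List.map (_⊕ r) occ) (toList (Vec.map (rotate r) ts)) ≡
  List.map (_⊕ r) (List.foldl parkCar occ (toList ts))
foldl-parkCar-rotate r occ []       = refl
foldl-parkCar-rotate r occ (t ∷ ts) = trans
  (cong (λ o → List.foldl parkCar o (toList (Vec.map (rotate r) ts))) (parkCar-rotate r occ t))
  (foldl-parkCar-rotate r (parkCar occ t) ts)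

emptySpot-rotate : (r : ℕ) (A : Preferences (suc n) s) {e : Fin (suc n)} →
  EmptySpot A e → EmptySpot (Vec.map (rotate r) A) (e ⊕ r)
emptySpot-rotate {n} r A {e} (e∉ , e!) rewrite foldl-parkCar-rotate r [] A =
  (e∉ ∘ ∈-map-injective (⊕-injective r)) , λ i i∉ → begin
    i              ≡⟨ ⊕-inverse′ i r ⟨
    -- Rotated back by `r * n`, the spot `i` is free in the original process and hence equal to `e`.
    i ⊕ r * n ⊕ r  ≡⟨ cong (_⊕ r) (e! (i ⊕ r * n) λ i∈ →
                        i∉ (subst (_∈ _) (⊕-inverse′ i r) (∈-map⁺ (_⊕ r) i∈))) ⟩
    e ⊕ r          ∎

-- Existence and uniqueness of the empty spot.

∈-visited : (t : Tuple (suc n) (suc s)) (x : Fin (suc n)) → x ∈ visited t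
∈-visited {n} t@(_ ∷ _) x =
  subst (_∈ visited t)
    (trans (⊕-% (last t) (distance (last t) x)) (⊕-distance (last t) x))
    (reach (distance (last t) x % suc n) (m%n<n (distance (last t) x) (suc n)))
  where
  reach : ∀ k → k < suc n → last t ⊕ k ∈ visited t
  -- The sweep covers the displacements 1 to `n`; displacement 0 is the last choice itself, an entry
  -- of the tuple. Since `0 * suc n` computes to 0, `⊕-multiple` gives `last t ⊕ 0 ≡ last t`.
  reach zero    _ = subst (_∈ visited t) (sym (⊕-multiple (last t) 0)) (∈-++⁺ˡ (last∈toList t))
  reach (suc k) k<n = ∈-++⁺ʳ (toList t) (∈-applyUpTo⁺ (λ i → last t ⊕ suc i) (s≤s⁻¹ k<n))

parkCar-free : (occ : List (Fin (suc n))) (t : Tuple (suc n) (suc s)) → length occ < suc n →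
  ∃[ x ] x ∉ occ × parkCar occ t ≡ x ∷ occ
parkCar-free occ t occ<
  with x , x∉ ← ∃∉ occ occ<
  with y , y∉ , eq ← find⁺ (λ x → _∉?_ _≟_ x occ) (lose (∈-visited t x) x∉) =
  y , y∉ , cong (maybe (_∷ occ) occ) eq

-- Before each car at most n - 1 of the n + 1 spots are occupied, so the car finds a free one, and
-- the list grows by one new spot.
foldl-parkCar : (occ : List (Fin (suc n))) (ts : Vec (Tuple (suc n) (suc s)) k) →
  length occ + k ≤ n → Unique occ →
  let occ′ = List.foldl parkCar occ (toList ts) in
  Unique occ′ × length occ′ ≡ length occ + k
foldl-parkCar occ [] _ occ! = occ! , sym (+-identityʳ _)
foldl-parkCar {k = suc k} occ (t ∷ ts) occ+k≤n occ!
  rewrite +-suc (length occ) k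
  with x , x∉ , eq ← parkCar-free occ t (m<n⇒m<1+n (m+n≤o⇒m≤o (suc (length occ)) occ+k≤n))
  rewrite eq = foldl-parkCar (x ∷ occ) ts occ+k≤n (∉⇒Unique-∷ x∉ occ!)

-- The `n` cars occupy `n` distinct spots out of n + 1, so some spot is left over.
∃-emptySpot : (A : Preferences (suc n) (suc s)) → ∃[ e ] EmptySpot A e
∃-emptySpot {n} A
  with occ! , |occ| ← foldl-parkCar [] A (≤-reflexive refl) []
  with e , e∉ ← ∃∉ (occupied A) (s≤s (≤-reflexive |occ|)) =
  e , e∉ , only
  where
  only : ∀ i → i ∉ occupied A → i ≡ e
  only i i∉ with i ≟ e
  ... | yes i≡e = i≡e
  -- Two different free spots and the `n` occupied ones would be n + 2 distinct spots on a circle of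
  -- n + 1.
  ... | no  i≢e = contradiction
    (subst (λ l → suc (suc l) ≤ suc n) |occ|
      (unique⇒length≤ (∉⇒Unique-∷ i∉e∷occ (∉⇒Unique-∷ e∉ occ!))))
    (n≮n _)
    where
    i∉e∷occ : i ∉ e ∷ occupied A
    i∉e∷occ (here i≡e) = i≢e i≡e
    i∉e∷occ (there i∈) = i∉ i∈

emptySpot-unique : (A : Preferences m s) {i j : Fin m} → EmptySpot A i → EmptySpot A j → i ≡ j
emptySpot-unique A (i∉ , _) (_ , j!) = j! _ i∉

-- Preferences of an increment class, parametrised by anchors.

tuples : Vec (Increments s) k → Vec (Fin m) k → Vec (Tuple m s) k
tuples κ a = Vec.zipWith tuple a κ

tuples-rotate : (r : ℕ) (κ : Vec (Increments s) k) (a : Vec (Fin (suc n)) k) →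
  tuples {s = s} κ (rotate r a) ≡ Vec.map (rotate r) (tuples κ a)
tuples-rotate r []      []      = refl
tuples-rotate r (k ∷ κ) (x ∷ a) = cong₂ _∷_ (tuple-⊕ r x k) (tuples-rotate r κ a)

emptySpot-tuples-rotate : (r : ℕ) (κ : IncrementMatrix (suc n) s) (a : Vec (Fin (suc n)) n)
  {e : Fin (suc n)} →
  EmptySpot {s = s} (tuples κ a) e → EmptySpot {s = s} (tuples κ (rotate r a)) (e ⊕ r)
emptySpot-tuples-rotate {s = s} r κ a empty =
  subst (λ A → EmptySpot {s = s} A _) (sym (tuples-rotate r κ a))
    (emptySpot-rotate r (tuples κ a) empty)

-- The first entry is the anchor displaced by the empty sum 0, so the anchor can be read off from
-- the tuple.
tuple-injective : (k : Increments (suc s)) →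
  Injective _≡_ _≡_ (λ (a : Fin (suc n)) → tuple {s = suc s} a k)
tuple-injective k eq = ⊕-injective 0 (proj₁ (∷-injective eq))

tuples-injective : (κ : Vec (Increments (suc s)) k) →
  Injective _≡_ _≡_ (tuples {s = suc s} {m = suc n} κ)
tuples-injective []      {[]}    {[]}    _  = refl
tuples-injective {s = s} (k ∷ κ) {x ∷ a} {y ∷ b} eq = cong₂ _∷_
  (tuple-injective {s = s} k (proj₁ (∷-injective eq)))
  (tuples-injective κ (proj₂ (∷-injective eq)))

module _ {m s d : ℕ} where

  -- Together with `pointwise⇒tuples` this identifies the class of an admissible `κ` with the image
  -- of `tuples κ`.
  pointwise-tuples : {κ : Vec (Increments s) k} → VecAll.All (AdmissibleIncrements m d {s}) κ →
    (a : Vec (Fin m) k) → Pointwise (HasIncrements d {m} {s}) (tuples κ a) κ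
  pointwise-tuples []       []      = []
  pointwise-tuples (p ∷ ps) (x ∷ a) = (p , x , refl) ∷ pointwise-tuples ps a

  pointwise⇒admissible : {κ : Vec (Increments s) k} {A : Vec (Tuple m s) k} →
    Pointwise (HasIncrements d) A κ → VecAll.All (AdmissibleTuple d) A
  pointwise⇒admissible []       = []
  pointwise⇒admissible (p ∷ ps) = (_ , p) ∷ pointwise⇒admissible ps

  pointwise⇒tuples : {κ : Vec (Increments s) k} {A : Vec (Tuple m s) k} →
    Pointwise (HasIncrements d) A κ → ∃[ a ] A ≡ tuples κ a
  pointwise⇒tuples []                   = [] , refl
  pointwise⇒tuples ((_ , x , eq) ∷ ps) with a , eqs ← pointwise⇒tuples ps =
    x ∷ a , cong₂ _∷_ eq eqs

-- Rotation orbits and the preferences with empty spot `j`.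

module _ {p s : ℕ}
         (κ : IncrementMatrix (suc (suc p)) (suc s)) (j : Fin (suc (suc p))) where

  private
    prefs : Vec (Fin (suc (suc p))) (suc p) → Preferences (suc (suc p)) (suc s)
    prefs = tuples κ

    empty₀ : Vec (Fin (suc (suc p))) p → Fin (suc (suc p))
    empty₀ b = proj₁ (∃-emptySpot (prefs (zero ∷ b)))

    emptySpot₀ : ∀ b → EmptySpot (prefs (zero ∷ b)) (empty₀ b)
    emptySpot₀ b = proj₂ (∃-emptySpot (prefs (zero ∷ b)))

  turn : Vec (Fin (suc (suc p))) p → ℕ
  turn b = distance (empty₀ b) j

  -- The member with empty spot `j` of the rotation orbit represented by `zero ∷ b`.
  fibre : Vec (Fin (suc (suc p))) p → Preferences (suc (suc p)) (suc s)
  fibre b = prefs (rotate (turn b) (zero ∷ b))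

  -- The first anchor of `fibre b` is `zero ⊕ turn b`. It reveals the rotation that was applied, and
  -- undoing this rotation on the other anchors recovers `b`.
  fibre-injective : Injective _≡_ _≡_ fibre
  fibre-injective {b} {c} eq = map-injective (⊕-injective (turn b)) (begin
    rotate (turn b) b ≡⟨ proj₂ (∷-injective anchors≡) ⟩
    rotate (turn c) c ≡⟨ map-cong same-turn c ⟨
    rotate (turn b) c ∎)
    where
    anchors≡ : rotate (turn b) (zero ∷ b) ≡ rotate (turn c) (zero ∷ c)
    anchors≡ = tuples-injective {s = s} κ eq

    same-turn : ∀ x → x ⊕ turn b ≡ x ⊕ turn c
    same-turn = ⊕-free {k = turn b} {l = turn c} zero (proj₁ (∷-injective anchors≡))

  emptySpot-fibre : ∀ b → EmptySpot (fibre b) j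
  emptySpot-fibre b = subst (EmptySpot (fibre b)) (⊕-distance (empty₀ b) j)
    (emptySpot-tuples-rotate {s = suc s} (turn b) κ (zero ∷ b) (emptySpot₀ b))

  -- The first anchor of `A` shows by how much `A` is rotated from its representative; as the empty
  -- spot is unique, that rotation acts as `turn b` does.
  fibre-surjective : ∀ {d A} →
    IncrementClass (suc (suc p)) (suc s) d κ A × EmptySpot A j → ∃[ b ] A ≡ fibre b
  fibre-surjective ((_ , A∼κ) , empty) with x ∷ a , refl ← pointwise⇒tuples A∼κ =
    b , cong prefs (begin
      x ∷ a                      ≡⟨ x∷a≡ ⟩
      rotate r (zero ∷ b)        ≡⟨ map-cong (⊕-free (empty₀ b) same-turn) (zero ∷ b) ⟩
      rotate (turn b) (zero ∷ b) ∎)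
    where
    -- `r` takes `zero` to the first anchor, and `b` is the rest rotated back: `suc p` is -1 modulo
    -- the number of spots.
    r = distance zero x
    b = rotate (r * suc p) a

    x∷a≡ : x ∷ a ≡ rotate r (zero ∷ b)
    x∷a≡ = cong₂ _∷_ (sym (⊕-distance zero x)) (begin
      a           ≡⟨ map-id a ⟨
      Vec.map _ a ≡⟨ map-cong (λ y → sym (⊕-inverse′ y r)) a ⟩
      Vec.map _ a ≡⟨ map-∘ (_⊕ r) (_⊕ r * suc p) a ⟩
      rotate r b  ∎)

    same-turn : empty₀ b ⊕ r ≡ empty₀ b ⊕ turn b
    -- Both sides are `j`: the left one because rotating the representative by `r` gives back `A`,
    -- the right one by the choice of `turn`.
    same-turn = trans
      (emptySpot-unique (prefs (rotate r (zero ∷ b)))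
        (emptySpot-tuples-rotate {s = suc s} r κ (zero ∷ b) (emptySpot₀ b))
        (subst (λ a → EmptySpot (prefs a) j) x∷a≡ empty))
      (sym (⊕-distance (empty₀ b) j))

theorem2 : (s d m : ℕ) → 1 ≤ s → 1 ≤ d → 2 ≤ m →
    let n = m ∸ 1 in
    (κ : IncrementMatrix m s) → AdmissibleMatrix m s d κ →
    (j : Fin m) →
    HasCardinality (λ A → IncrementClass m s d κ A × EmptySpot A j) (m ^ (n ∸ 1))
theorem2 (suc s) d (suc (suc p)) _ _ (s≤s (s≤s _)) κ κ-adm j =
  hasCardinality-image (fibre κ j) (fibre-injective κ j)
    (λ b → let A∼κ = pointwise-tuples κ-adm _
           in (pointwise⇒admissible A∼κ , A∼κ) , emptySpot-fibre κ j b)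
    (fibre-surjective κ j)
    -- Of the `suc p` anchors the first is fixed at `zero` in each representative, which leaves `p`,
    -- that is n - 1, free ones.
    (hasCardinality-Vec (suc (suc p)) p)
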